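{- For every natural number $n$, there are a theory $\Gamma_{n+1}$ and a sentence $\varphi$ in the language $\mathcal{L}_2$ (over some set $P$ of nouns and some set $R$ of verbs) such that $\Gamma_{n+1}\models\varphi$ and $\Gamma_{n+1}\not\models_n\varphi$. As a consequence, there is no sound and complete syllogistic proof system for $\mathcal{L}_2$.
   Context: Syntax of $\mathcal{L}_2$. Given a set $P$ of nouns and a set $R$ of verbs (these sets may be arbitrarily large), the terms are: every noun $p\in P$ is a term; if $r\in R$ and $x$ is a term then $(r\ \mathsf{all}\ x)$ is a term. The sentences are $(\mathsf{all}\ x\ y)$ and $(\mathsf{some}\ x\ y)$ for terms $x,y$. A theory is a set of sentences. Semantics. A model $\mathcal{M}$ is a set $M$ (possibly empty) with subsets $[\![p]\!]\subseteq M$ for $p\in P$ and relations $[\![r]\!]\subseteq M\times M$ for $r\in R$. Put $[\![r\ \mathsf{all}\ x]\!]=\{m\in M: m\,[\![r]\!]\,n\text{ for all }n\in[\![x]\!]\}$. $\mathcal{M}\models(\mathsf{all}\ x\ y)$ iff $[\![x]\!]\subseteq[\![y]\!]$; $\mathcal{M}\models(\mathsf{some}\ x\ y)$ iff $[\![x]\!]\cap[\![y]\!]\neq\emptyset$. $\Gamma\models\varphi$ means every model satisfying all sentences of $\Gamma$ satisfies $\varphi$. Degree $k$ consequence. $\Gamma\models_k\varphi$ holds if there is a finite tree with root labeled $\varphi$, nodes labeled by sentences, such that each node either is a leaf whose label is in $\Gamma$, or is labeled by a sentence $\psi$ and has children labeled $\psi_1,\dots,\psi_j$ for some $j\le k$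 with $\{\psi_1,\dots,\psi_j\}\models\psi$. Syllogistic proof systems. Term templates are built like terms but using noun variables and verb variables in place of nouns and verbs, and additionally allowing term variables as templates; sentence templates are built from term templates as sentences are built from terms, and additionally a sentence variable is a sentence template. A syllogistic rule consists of finitely many (possibly zero) sentence templates as premises and one sentence template as conclusion. A syllogistic proof system is a finite set of syllogistic rules (the same rules are used for all choices of $P$ and $R$). A substitution instance of a rule is obtained by substituting nouns, verbs, terms, sentences for noun, verb, term, sentence variables respectively. $\Gamma\vdash^*\varphi$ means there is a finite tree with root $\varphi$ in which each node is either a leaf belonging to $\Gamma$, or is the conclusion, with its children the premises, of a substitution instance of a rule. The system is sound if $\Gamma\vdash^*\varphi$ implies $\Gamma\models\varphi$, and complete if $\Gamma\models\varphi$ implies $\Gamma\vdash^*\varphi$, for all theories $\Gamma$ and sentences $\varphi$ (over all sets $P$, $R$). -}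

module Defs where

open import Data.Fin.Base using (Fin)
open import Data.List.Base using (List; length; map)
open import Data.List.Membership.Propositional using () renaming (_∈_ to _∈ₗ_)
open import Data.List.Relation.Unary.All using (All)
open import Data.Nat.Base using (ℕ; _≤_)
open import Level using (0ℓ)
open import Relation.Binary.Core using (Rel)
open import Relation.Unary using (Pred; _∈_; _⊆_; _∩_; Satisfiable)

data Term (P R : Set) : Set where
  noun   : P → Term P R
  _allOf_ : R → Term P R → Term P R

data Sentence (P R : Set) : Set where
  all some : Term P R → Term P R → Sentence P R

Theory : Set → Set → Set₁
Theory P R = Pred (Sentence P R) 0ℓ

-- The carrier may be empty.
record Model (P R : Set) : Set₁ where
  field
    Carrier : Set
    nounᴹ   : P → Pred Carrier 0ℓ
    verbᴹ   : R → Rel Carrier 0ℓ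

  ⟦_⟧ : Term P R → Pred Carrier 0ℓ
  ⟦ noun p ⟧ = nounᴹ p
  ⟦ r allOf x ⟧ m = ∀ n → n ∈ ⟦ x ⟧ → verbᴹ r m n

module _ {P R : Set} where

  infix 4 _⊩_ _⊨_ _⊨[_]_

  _⊩_ : Model P R → Sentence P R → Set
  M ⊩ all x y  = let open Model M in ⟦ x ⟧ ⊆ ⟦ y ⟧
  M ⊩ some x y = let open Model M in Satisfiable (⟦ x ⟧ ∩ ⟦ y ⟧)

  _⊨_ : Theory P R → Sentence P R → Set₁
  Γ ⊨ φ = (M : Model P R) → (∀ ψ → ψ ∈ Γ → M ⊩ ψ) → M ⊩ φ

  -- Degree k consequence; an element is a finite tree as in the definition.
  data _⊨[_]_ (Γ : Theory P R) (k : ℕ) : Sentence P R → Set₁ where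
    leaf : ∀ {ψ} → ψ ∈ Γ → Γ ⊨[ k ] ψ
    node : ∀ {ψ} (ψs : List (Sentence P R)) → length ψs ≤ k →
           (_∈ₗ ψs) ⊨ ψ → All (Γ ⊨[ k ]_) ψs → Γ ⊨[ k ] ψ

-- The numbers of noun, verb, term and sentence variables available to a rule.
-- Bounding them per rule matters: a rule without verb variables must have
-- instances even when R is empty, so a substitution cannot be required to
-- supply values for variables outside the rule.
record Variables : Set where
  field
    #nouns #verbs #terms #sentences : ℕ

module _ (V : Variables) where
  open Variables V

  data TermTemplate : Set where
    termVar : Fin #terms → TermTemplate
    nounVar : Fin #nouns → TermTemplate
    _allOf_ : Fin #verbs → TermTemplate → TermTemplate

  data SentenceTemplate : Set where
    sentenceVar : Fin #sentences → SentenceTemplate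
    all some    : TermTemplate → TermTemplate → SentenceTemplate

  record Substitution (P R : Set) : Set where
    field
      onNoun     : Fin #nouns → P
      onVerb     : Fin #verbs → R
      onTerm     : Fin #terms → Term P R
      onSentence : Fin #sentences → Sentence P R

module _ {V : Variables} {P R : Set} (σ : Substitution V P R) where
  open Substitution σ

  substTerm : TermTemplate V → Term P R
  substTerm (termVar i) = onTerm i
  substTerm (nounVar i) = noun (onNoun i)
  substTerm (i allOf t) = onVerb i allOf substTerm t

  substSentence : SentenceTemplate V → Sentence P R
  substSentence (sentenceVar i) = onSentence i
  substSentence (all s t)       = all (substTerm s) (substTerm t)
  substSentence (some s t)      = some (substTerm s) (substTerm t)

record Rule : Set where
  field
    variables  : Variables
    premises   : List (SentenceTemplate variables)
    conclusion : SentenceTemplate variables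

ProofSystem : Set
ProofSystem = List Rule

infix 4 _⊢[_]_

data _⊢[_]_ {P R : Set} (Γ : Theory P R) (S : ProofSystem) : Sentence P R → Set where
  leaf : ∀ {ψ} → ψ ∈ Γ → Γ ⊢[ S ] ψ
  node : ∀ {ρ} → ρ ∈ₗ S → let open Rule ρ in
         (σ : Substitution variables P R) →
         All (Γ ⊢[ S ]_) (map (substSentence σ) premises) →
         Γ ⊢[ S ] substSentence σ conclusion

Sound : ProofSystem → Set₁
Sound S = ∀ {P R : Set} (Γ : Theory P R) (φ : Sentence P R) → Γ ⊢[ S ] φ → Γ ⊨ φ

Complete : ProofSystem → Set₁
Complete S = ∀ {P R : Set} (Γ : Theory P R) (φ : Sentence P R) → Γ ⊨ φ → Γ ⊢[ S ] φ

{-# OPTIONS --safe #-}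
module Submission where

-- Why the theorem holds.
--
-- Fix k.  With two nouns, goal and base, and verbs r, s 0, s 1, ..., put
--   t = r all goal,   a i = (s i) all base,   b i = (s i) all t.
-- The theory Γ says that a 0 is nonempty, that a i is contained in b (i + 1)
-- for every i, and that a (k + 2) is contained in goal.  It entails
-- "some goal goal": if goal were empty, then t would be the whole model, so
-- b i would be contained in a i for every i, and an element of a 0 would pass
-- along a 0, a 1, ..., a (k + 2) into goal.
--
-- This case split cannot be simulated by consequences of degree k.  Let ⊑ be
-- the least relation on terms that is reflexive, contains the inclusions of Γ
-- and is antitone under every verb.  It is transitive, and each of its
-- instances x ⊑ y uses at most one inclusion of Γ.  Let T consist of the
-- sentences (all x y) with x ⊑ y and (some x y) with a 0 ⊑ x and a 0 ⊑ y.
-- Then T contains Γ and omits "some goal goal", and T is closed under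
-- consequences with at most k premises (T-closed):
--
--   * (all x y) not in T fails in the canonical model, whose elements are the
--     terms and where the term x denotes the terms below x;
--
--   * for (some x y) not in T, one of x, y is a term u not above a 0, and it
--     suffices to find a model of the premises in which u is empty.  If u is
--     base, t or r all a (k + 2), a one-point model does it.  If u is goal, a
--     one-point model does it that violates only one of the inclusions
--     a i ⊑ b (i + 1), where 1 ≤ i ≤ k + 1 may be chosen freely; since a
--     premise depends on at most one inclusion, k premises leave some i
--     unused.  For any other u, delete from the canonical model all terms
--     below u: base, goal, t and a 0 remain, so the resulting model still
--     satisfies Γ and T, and u is empty in it.
--
-- Finally, in a sound proof system every derivation is a derivation of degree
-- k, where k is the largest number of premises of a rule; so a sound and
-- complete system would contradict the first part.

open import Defs
open import Axiom.ExcludedMiddle using (ExcludedMiddle)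
open import Data.Empty using (⊥)
open import Data.Fin.Base using (Fin; toℕ)
open import Data.Fin.Properties using (pigeonhole; ¬∀⟶∃¬; toℕ-injective; toℕ<n)
  renaming (<⇒≢ to <⇒≢ᶠ)
open import Data.List.Base using (List; []; _∷_; length; lookup; map)
open import Data.List.Extrema.Nat using (max; xs≤max)
open import Data.List.Membership.Propositional using () renaming (_∈_ to _∈ₗ_)
open import Data.List.Membership.Propositional.Properties using (∈-map⁺)
open import Data.List.Properties using (length-map)
open import Data.List.Relation.Unary.All as All using (All; []; _∷_)
open import Data.List.Relation.Unary.All.Properties using (¬Any⇒All¬)
open import Data.List.Relation.Unary.Any as Any using (Any)
open import Data.List.Relation.Unary.Any.Properties using (lookup-result)
open import Data.Nat.Base using (ℕ; zero; suc; _≤_; _<_; z≤n; s≤s)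
open import Data.Nat.Properties
  using (≤-refl; ≤-reflexive; ≤-trans; <-irrefl; <⇒≤; ≤∧≢⇒<; suc-injective)
  renaming (_≟_ to _≟ℕ_)
open import Data.Product.Base using (∃-syntax; Σ-syntax; _×_; _,_; proj₁; proj₂)
open import Data.Sum.Base using (_⊎_; inj₁; inj₂)
open import Data.Unit.Base using (⊤; tt)
open import Level using (0ℓ)
open import Relation.Binary.PropositionalEquality
  using (_≡_; _≢_; refl; sym; trans; cong; subst)
open import Relation.Nullary.Decidable.Core using (yes; no; decidable-stable)
open import Relation.Nullary.Negation.Core using (¬_; contradiction)
open import Relation.Unary using (Pred; _∈_; Satisfiable)

-- If each of at most k objects violates at most one of k + 1 properties, then
-- some property is violated by none of them.
unviolated : ExcludedMiddle 0ℓ → ∀ {A : Set} {k} (Q : Fin (suc k) → Pred A 0ℓ)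
  (xs : List A) → length xs ≤ k →
  All (λ x → ∀ {i j} → i ≢ j → Q i x ⊎ Q j x) xs → ∃[ i ] All (Q i) xs
unviolated em {A} {k} Q xs len atMostOne =
  let i , none = ¬∀⟶∃¬ _ Violated (λ _ → em) notAll
  in i , All.map (decidable-stable em) (¬Any⇒All¬ xs none)
  where
  Violated : Fin (suc k) → Set
  Violated i = Any (λ x → ¬ Q i x) xs

  notAll : ¬ (∀ i → Violated i)
  notAll v with pigeonhole (s≤s len) (λ i → Any.index (v i))
  ... | i , j , i<j , same
    with All.lookupAny atMostOne (v i)
  ... | one , ¬Qi with one (<⇒≢ᶠ i<j)
  ... | inj₁ Qi = ¬Qi Qi
  ... | inj₂ Qj = subst (λ l → ¬ Q j (lookup xs l)) (sym same)
                    (lookup-result (v j)) Qj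

-- The language

data Noun : Set where
  base goal : Noun

data Verb : Set where
  r : Verb
  s : ℕ → Verb

Tm : Set
Tm = Term Noun Verb

Sen : Set
Sen = Sentence Noun Verb

t : Tm
t = r allOf noun goal

a b : ℕ → Tm
a i = s i allOf noun base
b i = s i allOf t

-- The last noun of a term.
lastNoun : Tm → Noun
lastNoun (noun p)    = p
lastNoun (v allOf x) = lastNoun x

-- The number of verbs of a term.
depth : Tm → ℕ
depth (noun p)    = zero
depth (v allOf x) = suc (depth x)

-- The argument for a fixed degree k

module Degree (em : ExcludedMiddle 0ℓ) (k : ℕ) where

  N : ℕ
  N = suc (suc k)

  -- The inclusions of the theory.
  data Step : Tm → Tm → Set where
    link  : ∀ i → Step (a i) (b (suc i))
    final : Step (a N) (noun goal)

  -- The last inclusion shares its index with link 0: no model used below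
  -- violates either of them.
  stepIndex : ∀ {x y} → Step x y → ℕ
  stepIndex (link i) = i
  stepIndex final    = zero

  -- The theory.  It has the links for all i, also for i ≥ N, where they are
  -- not needed for the entailment.
  data Γ : Theory Noun Verb where
    start : Γ (some (a 0) (a 0))
    step  : ∀ {x y} → Step x y → Γ (all x y)

  φ : Sen
  φ = some (noun goal) (noun goal)

  Γ⊨φ : Γ ⊨ φ
  Γ⊨φ M sat with em {Satisfiable (Model.⟦_⟧ M (noun goal))}
  ... | yes (m , h)  = m , h , h
  ... | no goalEmpty = m , inGoal , inGoal
    where
    open Model M
    m = proj₁ (sat _ start)

    inA : ∀ i → m ∈ ⟦ a i ⟧
    inA zero    = proj₁ (proj₂ (sat _ start))
    -- Every element lies in t, as goal is empty.
    inA (suc i) n _ =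
      sat _ (step (link i)) (inA i) n (λ l h → contradiction (l , h) goalEmpty)

    inGoal : m ∈ ⟦ noun goal ⟧
    inGoal = sat _ (step final) (inA N)

  -- The order generated by the inclusions

  infix 4 _⊑_

  data _⊑_ : Tm → Tm → Set where
    ⊑-refl : ∀ {x} → x ⊑ x
    ⊑-step : ∀ {x y} → Step x y → x ⊑ y
    ⊑-anti : ∀ {v x y} → x ⊑ y → v allOf y ⊑ v allOf x

  -- The index of the only inclusion used; for reflexivity, which uses none, a
  -- default value.
  index : ∀ {x y} → x ⊑ y → ℕ
  index ⊑-refl     = zero
  index (⊑-step e) = stepIndex e
  index (⊑-anti p) = index p

  -- No two inclusions can be composed, even under verbs: only base lies below
  -- base, nothing but goal lies above goal, and only t lies below t.  This
  -- leaves the trivial cases.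
  ⊑-trans : ∀ {x y z} → x ⊑ y → y ⊑ z → x ⊑ z
  ⊑-trans ⊑-refl q = q
  ⊑-trans p ⊑-refl = p
  ⊑-trans (⊑-anti p) (⊑-anti q) = ⊑-anti (⊑-trans q p)
  ⊑-trans (⊑-step (link i)) (⊑-anti ⊑-refl) = ⊑-step (link i)
  ⊑-trans (⊑-step (link i)) (⊑-anti (⊑-anti (⊑-step ())))
  ⊑-trans (⊑-step (link i)) (⊑-anti (⊑-anti ⊑-refl)) = ⊑-step (link i)
  ⊑-trans (⊑-step (link i)) (⊑-step ())
  ⊑-trans (⊑-step final) (⊑-step ())
  ⊑-trans (⊑-anti ⊑-refl) (⊑-step e) = ⊑-step e
  ⊑-trans (⊑-anti (⊑-step ())) (⊑-step (link i))
  ⊑-trans (⊑-anti (⊑-step ())) (⊑-step final)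

  -- Every inclusion exchanges the two nouns at the end.
  ⊑-lastNoun : ∀ {x y} → x ⊑ y → lastNoun x ≡ lastNoun y → x ≡ y
  ⊑-lastNoun ⊑-refl     _  = refl
  ⊑-lastNoun (⊑-step (link i)) ()
  ⊑-lastNoun (⊑-step final) ()
  ⊑-lastNoun (⊑-anti p) eq = cong (_ allOf_) (sym (⊑-lastNoun p (sym eq)))

  -- A set of sentences closed under consequences of degree k

  -- The sentences that are to contain all those derivable from Γ in degree k.
  data T : Theory Noun Verb where
    all  : ∀ {x y} → x ⊑ y → T (all x y)
    some : ∀ {x y} → a 0 ⊑ x → a 0 ⊑ y → T (some x y)

  Γ⊆T : ∀ {ψ} → Γ ψ → T ψ
  Γ⊆T start    = some ⊑-refl ⊑-refl
  Γ⊆T (step e) = all (⊑-step e)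

  φ∉T : ¬ T φ
  φ∉T (some (⊑-step ()) _)

  -- An instance of ⊑ holds in every model of the inclusion that it uses.
  ⊑-sound : ∀ M {x y} (p : x ⊑ y) →
    (∀ {x′ y′} (e : Step x′ y′) → stepIndex e ≡ index p → M ⊩ all x′ y′) →
    M ⊩ all x y
  ⊑-sound M ⊑-refl     h m∈x = m∈x
  ⊑-sound M (⊑-step e) h m∈x = h e refl m∈x
  ⊑-sound M (⊑-anti p) h m∈vy n n∈x = m∈vy n (⊑-sound M p h n∈x)

  index-above-a0 : ∀ {x} (p : a 0 ⊑ x) → index p ≡ 0
  index-above-a0 ⊑-refl            = refl
  index-above-a0 (⊑-step (link .0)) = refl
  index-above-a0 (⊑-anti ⊑-refl)   = refl

  Γ⊨T : ∀ M → (∀ ψ → ψ ∈ Γ → M ⊩ ψ) → ∀ {ψ} → T ψ → M ⊩ ψ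
  Γ⊨T M sat (all p)    = ⊑-sound M p (λ e _ → sat _ (step e))
  Γ⊨T M sat (some p q) =
    let m , m∈a0 , _ = sat _ start
    in m , ⊑-sound M p (λ e _ → sat _ (step e)) m∈a0
         , ⊑-sound M q (λ e _ → sat _ (step e)) m∈a0

  -- Canonical models

  -- The canonical model on the terms with property Q.
  Canonical : Pred Tm 0ℓ → Model Noun Verb
  Canonical Q = record
    { Carrier = Σ[ x ∈ Tm ] Q x
    ; nounᴹ   = λ p (x , _) → x ⊑ noun p
    ; verbᴹ   = λ v (x , _) (y , _) → x ⊑ v allOf y
    }

  module _ (Q : Pred Tm 0ℓ) where
    open Model (Canonical Q)

    -- All proper subterms have property Q.
    Interior : Tm → Set
    Interior (noun p)    = ⊤
    Interior (v allOf x) = Q x × Interior x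

    below⇒∈ : ∀ y → Interior y → ∀ {x} {q : Q x} → x ⊑ y → (x , q) ∈ ⟦ y ⟧
    ∈⇒below : ∀ y → Interior y → ∀ {x} {q : Q x} → (x , q) ∈ ⟦ y ⟧ → x ⊑ y

    below⇒∈ (noun p)    _       x⊑p = x⊑p
    below⇒∈ (v allOf y) (_ , I) x⊑vy (z , q) z∈y =
      ⊑-trans x⊑vy (⊑-anti (∈⇒below y I {q = q} z∈y))

    ∈⇒below (noun p)    _       x∈p  = x∈p
    -- As y has property Q, it is itself an element of its denotation.
    ∈⇒below (v allOf y) (q , I) x∈vy = x∈vy (y , q) (below⇒∈ y I ⊑-refl)

    Canonical-Γ : Q (noun base) → Q (noun goal) → Q t → Q (a 0) →
                  ∀ ψ → ψ ∈ Γ → Canonical Q ⊩ ψ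
    Canonical-Γ qb qg qt qa _ start = (a 0 , qa) , a0∈a0 , a0∈a0
      where
      a0∈a0 : (a 0 , qa) ∈ ⟦ a 0 ⟧
      a0∈a0 = below⇒∈ (a 0) (qb , tt) {q = qa} ⊑-refl
    Canonical-Γ qb qg qt qa _ (step (link i)) {_ , q} m∈a =
      below⇒∈ (b (suc i)) (qt , qg , tt) {q = q}
        (⊑-trans (∈⇒below (a i) (qb , tt) {q = q} m∈a) (⊑-step (link i)))
    Canonical-Γ qb qg qt qa _ (step final) {_ , q} m∈a =
      ⊑-trans (∈⇒below (a N) (qb , tt) {q = q} m∈a) (⊑-step final)

  -- No proper subterm of u is below u: the two have the same last noun.
  interior-⋢ : ∀ u → Interior (λ x → ¬ x ⊑ u) u
  interior-⋢ u = go u refl ≤-refl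
    where
    go : ∀ y → lastNoun y ≡ lastNoun u → depth y ≤ depth u →
         Interior (λ x → ¬ x ⊑ u) y
    go (noun p)    _  _   = tt
    go (v allOf y) eq y<u =
      (λ y⊑u → <-irrefl (cong depth (⊑-lastNoun y⊑u eq)) y<u) , go y eq (<⇒≤ y<u)

  -- One-point models

  -- The one-point model with nouns and verbs given by their truth values.
  OnePoint : (Noun → Set) → (Verb → Set) → Model Noun Verb
  OnePoint n v = record
    { Carrier = ⊤ ; nounᴹ = λ p _ → n p ; verbᴹ = λ w _ _ → v w }

  baseEmpty : Model Noun Verb
  baseEmpty = OnePoint (λ { base → ⊥ ; goal → ⊤ }) (λ _ → ⊤)

  baseEmpty-Γ : ∀ ψ → ψ ∈ Γ → baseEmpty ⊩ ψ
  baseEmpty-Γ _ start           = tt , (λ _ _ → tt) , (λ _ _ → tt)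
  baseEmpty-Γ _ (step (link i)) = λ _ _ _ → tt
  baseEmpty-Γ _ (step final)    = λ _ → tt

  rEmpty : Model Noun Verb
  rEmpty = OnePoint (λ _ → ⊤) (λ { r → ⊥ ; (s _) → ⊤ })

  rEmpty-Γ : ∀ ψ → ψ ∈ Γ → rEmpty ⊩ ψ
  rEmpty-Γ _ start           = tt , (λ _ _ → tt) , (λ _ _ → tt)
  rEmpty-Γ _ (step (link i)) = λ _ _ _ → tt
  rEmpty-Γ _ (step final)    = λ _ → tt

  -- In the chain a 0, a 1, ... the terms up to a i are full and the later ones
  -- are empty; goal is empty.  Only link i is violated.
  cutAt : ℕ → Model Noun Verb
  cutAt i = OnePoint (λ { base → ⊤ ; goal → ⊥ }) (λ { r → ⊤ ; (s j) → j ≤ i })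

  module _ {i} (0<i : 0 < i) (i<N : i < N) where

    cutAt-step : ∀ {x y} (e : Step x y) → stepIndex e ≢ i → cutAt i ⊩ all x y
    cutAt-step (link j) j≢i m∈a _ _ = ≤∧≢⇒< (m∈a tt tt) j≢i
    cutAt-step final    _   m∈a     =
      <-irrefl refl (≤-trans i<N (m∈a tt tt))

    cutAt-⊑ : ∀ {x y} (p : x ⊑ y) → index p ≢ i → cutAt i ⊩ all x y
    cutAt-⊑ p p≢i =
      ⊑-sound (cutAt i) p (λ e eq → cutAt-step e (λ e≡i → p≢i (trans (sym eq) e≡i)))

    cutAt-some : ∀ {x y} → a 0 ⊑ x → a 0 ⊑ y → cutAt i ⊩ some x y
    cutAt-some p q = tt , above p , above q
      where
      above : ∀ {x} → a 0 ⊑ x → tt ∈ Model.⟦_⟧ (cutAt i) x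
      above p = cutAt-⊑ p
        (λ p≡i → <-irrefl (trans (sym (index-above-a0 p)) p≡i) 0<i) (λ _ _ → z≤n)

  -- The indices 1, ..., k + 1.
  cut : Fin (suc k) → ℕ
  cut i = suc (toℕ i)

  cutAt-atMostOne : ∀ {ψ} → T ψ → ∀ {i j} → i ≢ j →
                    cutAt (cut i) ⊩ ψ ⊎ cutAt (cut j) ⊩ ψ
  cutAt-atMostOne (some p q) {i} _ = inj₁ (cutAt-some (s≤s z≤n) (s≤s (toℕ<n i)) p q)
  cutAt-atMostOne (all p) {i} {j} i≢j with index p ≟ℕ cut i
  ... | no  p≢i = inj₁ (cutAt-⊑ (s≤s z≤n) (s≤s (toℕ<n i)) p p≢i)
  ... | yes p≡i = inj₂ (cutAt-⊑ (s≤s z≤n) (s≤s (toℕ<n j)) p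
    (λ p≡j → i≢j (toℕ-injective (suc-injective (trans (sym p≡i) p≡j)))))

  module _ {ψs : List Sen} (len : length ψs ≤ k) (ψs⊆T : All T ψs) where

    modelOfΓ : ∀ M → (∀ ψ → ψ ∈ Γ → M ⊩ ψ) → ∀ ψ → ψ ∈ₗ ψs → M ⊩ ψ
    modelOfΓ M sat ψ ψ∈ψs = Γ⊨T M sat (All.lookup ψs⊆T ψ∈ψs)

    -- If the premises force u to be nonempty, then u lies above a 0.  The cases
    -- are those of the models in which u is empty.
    nonempty⇒above-a0 : ∀ u →
      (∀ M → (∀ ψ → ψ ∈ₗ ψs → M ⊩ ψ) → Satisfiable (Model.⟦_⟧ M u)) → a 0 ⊑ u
    nonempty⇒above-a0 u nonempty = decidable-stable em emptyCase
      where
      baseCase : ¬ noun base ⊑ u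
      baseCase ⊑-refl = proj₂ (nonempty baseEmpty (modelOfΓ _ baseEmpty-Γ))

      goalCase : ¬ noun goal ⊑ u
      goalCase ⊑-refl =
        let i , sat = unviolated em (λ i → cutAt (cut i) ⊩_) ψs len
                        (All.map cutAt-atMostOne ψs⊆T)
        in proj₂ (nonempty (cutAt (cut i)) (λ _ → All.lookup sat))

      -- The terms above t are t and r all (a N).
      tCase : ¬ t ⊑ u
      tCase p with p | nonempty rEmpty (modelOfΓ _ rEmpty-Γ)
      ... | ⊑-refl                | _ , h = h tt tt
      ... | ⊑-anti ⊑-refl         | _ , h = h tt tt
      ... | ⊑-anti (⊑-step final) | _ , h = h tt (λ _ _ → tt)

      emptyCase : ¬ ¬ a 0 ⊑ u
      emptyCase a0⋢u =
        let (x , x⋢u) , x∈u = nonempty (Canonical Q)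
              (modelOfΓ _ (Canonical-Γ Q baseCase goalCase tCase a0⋢u))
        in x⋢u (∈⇒below Q u (interior-⋢ u) {q = x⋢u} x∈u)
        where
        Q : Pred Tm 0ℓ
        Q x = ¬ x ⊑ u

    T-closed : ∀ {ψ} → (_∈ₗ ψs) ⊨ ψ → T ψ
    T-closed {all x y} ψs⊨ψ = all (∈⇒below Q y (interior y) {q = tt}
        (ψs⊨ψ (Canonical Q) (modelOfΓ _ (Canonical-Γ Q tt tt tt tt))
          (below⇒∈ Q x (interior x) ⊑-refl)))
      where
      Q : Pred Tm 0ℓ
      Q _ = ⊤

      interior : ∀ x → Interior Q x
      interior (noun p)    = tt
      interior (v allOf x) = tt , interior x
    T-closed {some x y} ψs⊨ψ = some
      (nonempty⇒above-a0 x (λ M sat → let m , m∈x , _ = ψs⊨ψ M sat in m , m∈x))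
      (nonempty⇒above-a0 y (λ M sat → let m , _ , m∈y = ψs⊨ψ M sat in m , m∈y))

  ⊨[k]⇒T : ∀ {ψ} → Γ ⊨[ k ] ψ → T ψ
  ⊨[k]⇒T* : ∀ {ψs} → All (Γ ⊨[ k ]_) ψs → All T ψs
  ⊨[k]⇒T (leaf ψ∈Γ)             = Γ⊆T ψ∈Γ
  ⊨[k]⇒T (node ψs len ψs⊨ψ ds) = T-closed len (⊨[k]⇒T* ds) ψs⊨ψ
  ⊨[k]⇒T* []       = []
  ⊨[k]⇒T* (d ∷ ds) = ⊨[k]⇒T d ∷ ⊨[k]⇒T* ds

  Γ⊭[k]φ : ¬ (Γ ⊨[ k ] φ)
  Γ⊭[k]φ d = φ∉T (⊨[k]⇒T d)

-- Syllogistic proof systems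

#premises : Rule → ℕ
#premises ρ = length (Rule.premises ρ)

-- The largest number of premises of a rule.
width : ProofSystem → ℕ
width S = max 0 (map #premises S)

#premises≤width : ∀ {ρ S} → ρ ∈ₗ S → #premises ρ ≤ width S
#premises≤width {S = S} ρ∈S =
  All.lookup (xs≤max 0 (map #premises S)) (∈-map⁺ #premises ρ∈S)

module _ {S : ProofSystem} (sound : Sound S) {P R : Set} {Γ : Theory P R} where

  ⊢⇒⊨[width] : ∀ {ψ} → Γ ⊢[ S ] ψ → Γ ⊨[ width S ] ψ
  ⊢⇒⊨[width]* : ∀ {ψs} → All (Γ ⊢[ S ]_) ψs → All (Γ ⊨[ width S ]_) ψs
  ⊢⇒⊨[width] (leaf ψ∈Γ) = leaf ψ∈Γ
  ⊢⇒⊨[width] (node {ρ} ρ∈S σ ds) = node premisesσ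
    (≤-trans (≤-reflexive (length-map _ (Rule.premises ρ))) (#premises≤width ρ∈S))
    -- Soundness, applied to the one-step derivation from the premises.
    (sound (_∈ₗ premisesσ) _ (node ρ∈S σ (All.tabulate leaf)))
    (⊢⇒⊨[width]* ds)
    where premisesσ = map (substSentence σ) (Rule.premises ρ)
  ⊢⇒⊨[width]* []       = []
  ⊢⇒⊨[width]* (d ∷ ds) = ⊢⇒⊨[width] d ∷ ⊢⇒⊨[width]* ds

theorem2p11 : ExcludedMiddle 0ℓ →
    ((n : ℕ) → Σ[ P ∈ Set ] Σ[ R ∈ Set ] Σ[ Γ ∈ Theory P R ] Σ[ φ ∈ Sentence P R ] (Γ ⊨ φ) × ¬ (Γ ⊨[ n ] φ))
    × ¬ (Σ[ S ∈ ProofSystem ] Sound S × Complete S)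
theorem2p11 em = hierarchy , incomplete
  where
  hierarchy : (n : ℕ) → Σ[ P ∈ Set ] Σ[ R ∈ Set ] Σ[ Γ ∈ Theory P R ] Σ[ φ ∈ Sentence P R ] (Γ ⊨ φ) × ¬ (Γ ⊨[ n ] φ)
  hierarchy n = Noun , Verb , Γ , φ , Γ⊨φ , Γ⊭[k]φ
    where open Degree em n

  incomplete : ¬ (Σ[ S ∈ ProofSystem ] Sound S × Complete S)
  incomplete (S , sound , complete) =
    let _ , _ , Γ , φ , Γ⊨φ , Γ⊭φ = hierarchy (width S)
    in Γ⊭φ (⊢⇒⊨[width] sound (complete Γ φ Γ⊨φ))
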